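{- Let $\mathcal{H}=(V,E)$ be a linear hypergraph such that for every hyperedge $e\in E$ there exists a vertex $x\in e$ with $\mathrm{deg}_{\mathcal{H}}(x)\le |e|$. Then $$\mathrm{q}(\mathcal{H})\le \Delta([\mathcal{H}]_2)+1.$$
   Context: A hypergraph $\mathcal{H}=(V,E)$ has a finite vertex set $V$ and a finite set $E$ of nonempty subsets of $V$ (hyperedges). It is linear if $|e\cap e'|\le 1$ for all distinct $e,e'\in E$. The degree $\mathrm{deg}_{\mathcal{H}}(x)$ of a vertex $x$ is the number of hyperedges containing $x$. The 2-section $[\mathcal{H}]_2$ is the simple graph on $V$ in which two distinct vertices are adjacent iff some hyperedge contains both; $\Delta([\mathcal{H}]_2)$ is its maximum degree. The chromatic index $\mathrm{q}(\mathcal{H})$ is the least $k$ such that the hyperedges can be colored with $k$ colors so that any two distinct intersecting hyperedges receive different colors. -}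

module Defs where

open import Data.Nat.Base using (ℕ; zero; suc; _≤_; z≤n; s≤s)
open import Data.Fin.Base using (Fin; zero; suc; finToFun; funToFin)
open import Data.Fin.Properties using (_≟_; any?; all?; finToFun-funToFin)
open import Data.Fin.Subset using (Subset; _∈_; _∩_; ∣_∣; Nonempty)
open import Data.Fin.Subset.Properties using (_∈?_; nonempty?)
open import Data.List.Base using (length; filter; map; allFin)
open import Data.List.Extrema.Nat using (max)
open import Data.Product.Base using (∃; _×_; _,_; proj₁; proj₂)
open import Function.Base using (id; _∘_)
open import Function.Definitions using (Injective)
open import Relation.Binary.Definitions using (Decidable; Irreflexive; Symmetric)
open import Relation.Binary.PropositionalEquality using (_≡_; _≢_; refl; sym; trans; _≗_)
open import Relation.Nullary.Decidable using (Dec; yes; no; map′; ¬?; _×-dec_; _→-dec_)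
open import Relation.Nullary.Negation using (contradiction)

record SimpleGraph (n : ℕ) : Set₁ where
  field
    Adj    : Fin n → Fin n → Set
    adj?   : Decidable Adj
    symm   : Symmetric Adj
    irrefl : Irreflexive _≡_ Adj

  degree : Fin n → ℕ
  degree x = length (filter (adj? x) (allFin n))

  -- The maximum is 0 for the graph without vertices.
  maxDegree : ℕ
  maxDegree = max 0 (map degree (allFin n))

-- The vertex set is Fin n.  The set of hyperedges is the image of edge, whose
-- injectivity makes the m indices stand for m distinct subsets (no multi-edges).
record Hypergraph (n m : ℕ) : Set where
  field
    edge           : Fin m → Subset n
    edge-nonempty  : ∀ i → Nonempty (edge i)
    edge-injective : Injective _≡_ _≡_ edge

module _ {n m : ℕ} (H : Hypergraph n m) where
  open Hypergraph H

  Linear : Set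
  Linear = ∀ i j → i ≢ j → ∣ edge i ∩ edge j ∣ ≤ 1

  degree : Fin n → ℕ
  degree x = length (filter (λ i → x ∈? edge i) (allFin m))

  twoSection : SimpleGraph n
  twoSection = record
    { Adj    = λ x y → x ≢ y × ∃ λ i → x ∈ edge i × y ∈ edge i
    ; adj?   = λ x y → ¬? (x ≟ y) ×-dec any? λ i → (x ∈? edge i) ×-dec (y ∈? edge i)
    ; symm   = λ (x≢y , i , x∈e , y∈e) → x≢y ∘ sym , i , y∈e , x∈e
    ; irrefl = λ x≡y (x≢y , _) → x≢y x≡y
    }

  ProperEdgeColouring : ∀ {k} → (Fin m → Fin k) → Set
  ProperEdgeColouring c = ∀ i j → i ≢ j → Nonempty (edge i ∩ edge j) → c i ≢ c j

  EdgeColourable : ℕ → Set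
  EdgeColourable k = ∃ λ (c : Fin m → Fin k) → ProperEdgeColouring c

  IsChromaticIndex : ℕ → Set
  IsChromaticIndex k = EdgeColourable k × (∀ j → EdgeColourable j → k ≤ j)

  proper? : ∀ {k} (c : Fin m → Fin k) → Dec (ProperEdgeColouring c)
  proper? c = all? λ i → all? λ j →
    ¬? (i ≟ j) →-dec (nonempty? (edge i ∩ edge j) →-dec ¬? (c i ≟ c j))

  proper-resp-≗ : ∀ {k} {c d : Fin m → Fin k} → c ≗ d →
                  ProperEdgeColouring c → ProperEdgeColouring d
  proper-resp-≗ c≗d c-proper i j i≢j meet di≡dj =
    c-proper i j i≢j meet (trans (c≗d i) (trans di≡dj (sym (c≗d j))))

  edgeColourable? : ∀ k → Dec (EdgeColourable k)
  edgeColourable? k = map′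
    (λ (a , p) → finToFun a , p)
    (λ (c , p) → funToFin c , proper-resp-≗ (sym ∘ finToFun-funToFin c) p)
    (any? (λ a → proper? (finToFun a)))

least : ∀ {P : ℕ → Set} → (∀ k → Dec (P k)) → ∀ b → P b →
        ∃ λ k → P k × (∀ j → P j → k ≤ j)
least P? zero    pb = zero , pb , λ _ _ → z≤n
least P? (suc b) pb with P? zero
... | yes p0 = zero , p0 , λ _ _ → z≤n
... | no ¬p0 with least (P? ∘ suc) b pb
...   | k , pk , k-min = suc k , pk , λ where
          zero    p0 → contradiction p0 ¬p0
          (suc j) pj → s≤s (k-min j pj)

module _ {n m : ℕ} (H : Hypergraph n m) where

  -- Giving all m hyperedges different colours starts the search.
  chromaticIndex-exists : ∃ (IsChromaticIndex H)
  chromaticIndex-exists =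
    least (edgeColourable? H) m (id , λ i j i≢j _ → i≢j)

  chromaticIndex : ℕ
  chromaticIndex = proj₁ chromaticIndex-exists

  chromaticIndex-isChromaticIndex : IsChromaticIndex H chromaticIndex
  chromaticIndex-isChromaticIndex = proj₂ chromaticIndex-exists

{-# OPTIONS --safe #-}

-- Colour the hyperedges greedily in order of decreasing size.  When e, of size
-- s + 1, is reached, every coloured hyperedge has at least s + 1 vertices.  The
-- hyperedges of size at least s + 1 through a vertex y of e are, by linearity,
-- disjoint outside y, so there are at most Δ / s of them, e included.  At the
-- vertex x of e of degree at most s + 1 there are at most s hyperedges other
-- than e.  Altogether at most s (Δ / s − 1) + s = Δ coloured hyperedges meet e.

module Submission where

open import Defs
open import Data.Nat.Base using (ℕ; zero; suc; _+_; _*_; _≤_; _<_; z≤n)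
open import Data.Nat.Properties
  using (≤-refl; ≤-trans; ≤-reflexive; ≤-antisym; ≤-decTotalOrder; ≤-pred; _≤?_; <⇒≱;
         +-comm; +-mono-≤; +-monoˡ-≤; *-comm; *-cancelʳ-≤; module ≤-Reasoning)
open import Data.Nat.Solver using (module +-*-Solver)
open import Data.Fin.Base using (Fin; zero; suc)
open import Data.Fin.Properties using (_≟_; any?; injective⇒≤)
open import Data.Fin.Subset using (Subset; _∈_; _∩_; ∣_∣; Nonempty; inside; outside)
open import Data.Fin.Subset.Properties using (_∈?_; x∈p∩q⁺; x∈p∩q⁻; drop-there; ∩-comm)
open import Data.List.Base
  using (List; []; _∷_; _++_; length; filter; map; concatMap; allFin; tabulate; lookup)
open import Data.List.Properties using (length-++; length-map; length-tabulate)
open import Data.List.Extrema.Nat using (xs≤max)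
import Data.List.Membership.DecPropositional as DecMembership
open import Data.List.Membership.Propositional using (find; lose) renaming (_∈_ to _∈ˡ_; _∉_ to _∉ˡ_)
open import Data.List.Membership.Propositional.Properties
  using (∈-lookup; ∈-allFin; ∈-filter⁺; ∈-filter⁻; ∈-map⁺; ∈-concatMap⁺; ∈-concatMap⁻; ∈-++⁺ˡ; ∈-++⁺ʳ)
open import Data.List.Relation.Binary.Disjoint.Propositional using (Disjoint)
open import Data.List.Relation.Binary.Permutation.Propositional using (↭-sym)
open import Data.List.Relation.Binary.Permutation.Propositional.Properties using (∈-resp-↭)
open import Data.List.Relation.Binary.Subset.Propositional using (_⊆_)
open import Data.List.Relation.Unary.All as All using (All; []; _∷_)
open import Data.List.Relation.Unary.All.Properties using () renaming (map⁺ to All-map⁺)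
open import Data.List.Relation.Unary.AllPairs as AllPairs using (AllPairs; []; _∷_)
open import Data.List.Relation.Unary.AllPairs.Properties using () renaming (map⁺ to AllPairs-map⁺)
open import Data.List.Relation.Unary.Any using (here; there; index)
open import Data.List.Relation.Unary.Any.Properties using (lookup-index)
open import Data.List.Relation.Unary.Sorted.TotalOrder.Properties using (Sorted⇒AllPairs)
open import Data.List.Relation.Unary.Unique.Propositional using (Unique)
open import Data.List.Relation.Unary.Unique.Propositional.Properties
  using (allFin⁺; filter⁺; concat⁺)
import Data.List.Sort as Sort
open import Data.Product.Base using (∃; _×_; _,_; proj₁; proj₂)
open import Data.Vec.Base using ([]; _∷_; here; there)
open import Data.Vec.Functional using (updateAt)
open import Data.Vec.Functional.Properties using (updateAt-updates; updateAt-minimal)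
open import Function.Base using (_∘_; case_of_; const; id)
open import Function.Definitions using (Injective)
open import Relation.Binary.Bundles using (DecTotalOrder)
import Relation.Binary.Construct.On as On
open import Relation.Binary.Core using (Rel)
open import Relation.Binary.Definitions using (Symmetric)
open import Relation.Binary.PropositionalEquality
  using (_≡_; _≢_; refl; sym; trans; cong; subst; ≢-sym; module ≡-Reasoning)
open import Relation.Nullary.Decidable using (yes; no; ¬?; _×-dec_; decidable-stable)
open import Relation.Nullary.Negation using (contradiction)
open import Relation.Unary using (Pred; Decidable)
open import Level using (0ℓ)

-- Counting with repetition-free lists.

Unique-lookup-injective : ∀ {A : Set} {xs : List A} → Unique xs → Injective _≡_ _≡_ (lookup xs)
Unique-lookup-injective (_ ∷ _)   {zero}  {zero}  _  = refl
Unique-lookup-injective (x∉ ∷ _)  {zero}  {suc j} eq = contradiction eq (All.lookup x∉ (∈-lookup j))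
Unique-lookup-injective (x∉ ∷ _)  {suc i} {zero}  eq = contradiction (sym eq) (All.lookup x∉ (∈-lookup i))
Unique-lookup-injective (_ ∷ xs!) {suc i} {suc j} eq = cong suc (Unique-lookup-injective xs! eq)

-- Sending each position of `xs` to a position of the same entry in `ys` is injective, so the
-- pigeonhole principle applies.
Unique-⊆⇒length≤ : ∀ {A : Set} {xs ys : List A} → Unique xs → xs ⊆ ys → length xs ≤ length ys
Unique-⊆⇒length≤ {xs = xs} {ys} xs! xs⊆ys = injective⇒≤ position-injective
  where
  position : Fin (length xs) → Fin (length ys)
  position i = index (xs⊆ys (∈-lookup i))

  position-injective : Injective _≡_ _≡_ position
  position-injective {i} {j} eq = Unique-lookup-injective xs! (begin
    lookup xs i            ≡⟨ lookup-index (xs⊆ys (∈-lookup i)) ⟩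
    lookup ys (position i) ≡⟨ cong (lookup ys) eq ⟩
    lookup ys (position j) ≡⟨ lookup-index (xs⊆ys (∈-lookup j)) ⟨
    lookup xs j            ∎)
    where open ≡-Reasoning

module _ {k : ℕ} where
  open DecMembership (_≟_ {suc k}) using () renaming (_∈?_ to _∈ˡ?_)

  -- If every colour occurred in `xs`, the `suc k` colours would form a repetition-free list
  -- included in `xs`.
  fresh : (xs : List (Fin (suc k))) → length xs ≤ k → ∃ λ c → c ∉ˡ xs
  fresh xs short with any? (λ c → ¬? (c ∈ˡ? xs))
  ... | yes found = found
  ... | no  none  = contradiction short (<⇒≱ (begin
    suc k                   ≡⟨ length-tabulate id ⟨
    length (allFin (suc k)) ≤⟨ Unique-⊆⇒length≤ (allFin⁺ (suc k)) (λ {c} _ →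
                                 decidable-stable (c ∈ˡ? xs) (λ c∉ → none (c , c∉))) ⟩
    length xs               ∎))
    where open ≤-Reasoning

-- Subsets as lists.

-- The induction strips the head of `p` and replaces `f` by `f ∘ suc`; hence `P` is a predicate on
-- `A`, tied to `p` only through `f`.
length-filter-tabulate : ∀ {A : Set} {P : Pred A 0ℓ} (P? : Decidable P) {n} (f : Fin n → A) (p : Subset n) →
                         (∀ i → P (f i) → i ∈ p) → (∀ i → i ∈ p → P (f i)) →
                         length (filter P? (tabulate f)) ≡ ∣ p ∣
length-filter-tabulate P? {zero}  f []            to from = refl
length-filter-tabulate P? {suc n} f (inside  ∷ p) to from with P? (f zero)
... | yes _  = cong suc (length-filter-tabulate P? (f ∘ suc) p
                 (λ i → drop-there ∘ to (suc i)) (λ i → from (suc i) ∘ there))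
... | no  ¬p = contradiction (from zero here) ¬p
length-filter-tabulate P? {suc n} f (outside ∷ p) to from with P? (f zero)
... | yes pz = case to zero pz of λ ()
... | no  _  = length-filter-tabulate P? (f ∘ suc) p
                 (λ i → drop-there ∘ to (suc i)) (λ i → from (suc i) ∘ there)

members : ∀ {n} → Subset n → List (Fin n)
members {n} p = filter (_∈? p) (allFin n)

length-members : ∀ {n} (p : Subset n) → length (members p) ≡ ∣ p ∣
length-members p = length-filter-tabulate (_∈? p) id p (λ _ → id) (λ _ → id)

∈-members : ∀ {n} {x : Fin n} {p : Subset n} → x ∈ p → x ∈ˡ members p
∈-members x∈p = ∈-filter⁺ (_∈? _) (∈-allFin _) x∈p

-- Serves to contradict linearity, with `p` the intersection of two hyperedges.
distinct∈⇒1<∣p∣ : ∀ {n} {x y : Fin n} {p : Subset n} → x ≢ y → x ∈ p → y ∈ p → 1 < ∣ p ∣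
distinct∈⇒1<∣p∣ {x = x} {y} {p} x≢y x∈p y∈p = begin
  length (x ∷ y ∷ []) ≤⟨ Unique-⊆⇒length≤ ((x≢y ∷ []) ∷ [] ∷ []) (λ where
                           (here refl)         → ∈-members x∈p
                           (there (here refl)) → ∈-members y∈p) ⟩
  length (members p)  ≡⟨ length-members p ⟩
  ∣ p ∣               ∎
  where open ≤-Reasoning

-- Lengths of concatenations.

module _ {A B : Set} (f : A → List B) where

  length-concatMap-≥ : ∀ {s xs} → (∀ {x} → x ∈ˡ xs → s ≤ length (f x)) →
                       length xs * s ≤ length (concatMap f xs)
  length-concatMap-≥ {s} {[]}     s≤ = z≤n
  length-concatMap-≥ {s} {x ∷ xs} s≤ = begin
    s + length xs * s                      ≤⟨ +-mono-≤ (s≤ (here refl)) (length-concatMap-≥ (s≤ ∘ there)) ⟩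
    length (f x) + length (concatMap f xs) ≡⟨ length-++ (f x) ⟨
    length (concatMap f (x ∷ xs))          ∎
    where open ≤-Reasoning

  -- The products avoid the division in length (f x) ≤ Δ / s − 1.
  length-concatMap-≤ : ∀ {s Δ} xs → (∀ {x} → x ∈ˡ xs → suc (length (f x)) * s ≤ Δ) →
                       (length (concatMap f xs) + length xs) * s ≤ length xs * Δ
  length-concatMap-≤ {s} {Δ} []       ≤Δ = z≤n
  length-concatMap-≤ {s} {Δ} (x ∷ xs) ≤Δ = begin
    (length (f x ++ concatMap f xs) + suc (length xs)) * s
      ≡⟨ cong (λ l → (l + suc (length xs)) * s) (length-++ (f x)) ⟩
    (length (f x) + length (concatMap f xs) + suc (length xs)) * s
      ≡⟨ solve 4 (λ a b c s → (a :+ b :+ (con 1 :+ c)) :* s := (con 1 :+ a) :* s :+ (b :+ c) :* s)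
           refl (length (f x)) (length (concatMap f xs)) (length xs) s ⟩
    suc (length (f x)) * s + (length (concatMap f xs) + length xs) * s
      ≤⟨ +-mono-≤ (≤Δ (here refl)) (length-concatMap-≤ xs (≤Δ ∘ there)) ⟩
    Δ + length xs * Δ ∎
    where
    open ≤-Reasoning
    open +-*-Solver

-- Greedy colouring of a weighted graph.

-- Colouring vertices by decreasing weight, only the neighbours at least as
-- heavy as i, which are all listed in N i, are coloured before i.
module Greedy {m k : ℕ} {_~_ : Rel (Fin m) 0ℓ} (~-sym : Symmetric _~_) (w : Fin m → ℕ)
              (N : Fin m → List (Fin m))
              (N-complete : ∀ {i j} → i ≢ j → i ~ j → w i ≤ w j → j ∈ˡ N i)
              (N-short : ∀ i → length (N i) ≤ k) where

  ProperOn : List (Fin m) → (Fin m → Fin (suc k)) → Set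
  ProperOn L c = ∀ {i j} → i ∈ˡ L → j ∈ˡ L → i ≢ j → i ~ j → c i ≢ c j

  -- Only the colour of `i` changes. The new one avoids the values of `c` on all of `N i`, including
  -- vertices outside `L`; this costs nothing, as `N-short` bounds the whole list.
  extend : ∀ {i L c} → All (λ j → w i ≤ w j) L → ProperOn L c → ∃ (ProperOn (i ∷ L))
  extend {i} {L} {c} i≤L proper
    with a , a∉ ← fresh (map c (N i)) (subst (_≤ k) (sym (length-map c (N i))) (N-short i))
    = c′ , proper′
    where
    c′ : Fin m → Fin (suc k)
    c′ = updateAt c i (const a)

    c′-i : c′ i ≡ a
    c′-i = updateAt-updates i c

    c′-other : ∀ {j} → j ≢ i → c′ j ≡ c j
    c′-other = updateAt-minimal _ i c

    i-avoids : ∀ {j} → j ∈ˡ L → i ≢ j → i ~ j → c′ i ≢ c′ j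
    i-avoids j∈L i≢j i~j eq = a∉ (subst (_∈ˡ map c (N i))
      (sym (trans (sym c′-i) (trans eq (c′-other (≢-sym i≢j)))))
      (∈-map⁺ c (N-complete i≢j i~j (All.lookup i≤L j∈L))))

    proper′ : ProperOn (i ∷ L) c′
    proper′ (here refl) (here refl) i≢i _ = contradiction refl i≢i
    proper′ (here refl) (there k∈L) = i-avoids k∈L
    proper′ (there j∈L) (here refl) j≢i j~i = ≢-sym (i-avoids j∈L (≢-sym j≢i) (~-sym j~i))
    -- `L` may contain `i` again; that occurrence is recoloured too, so the pair falls under
    -- `i-avoids`.
    proper′ {j} {l} (there j∈L) (there l∈L) j≢l j~l with j ≟ i | l ≟ i
    ... | yes refl | _        = i-avoids l∈L j≢l j~l
    ... | no  _    | yes refl = ≢-sym (i-avoids j∈L (≢-sym j≢l) (~-sym j~l))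
    ... | no  j≢i  | no  l≢i  = λ eq → proper j∈L l∈L j≢l j~l
                                  (trans (sym (c′-other j≢i)) (trans eq (c′-other l≢i)))

  -- The list ascends in weight and the recursion colours its tail first, so the heaviest vertices
  -- come first in the greedy order.
  colourList : ∀ {L} → AllPairs (λ i j → w i ≤ w j) L → ∃ (ProperOn L)
  colourList []            = const zero , λ ()
  colourList (i≤L ∷ sorted) = extend i≤L (proj₂ (colourList sorted))

  byWeight : DecTotalOrder 0ℓ 0ℓ 0ℓ
  byWeight = On.decTotalOrder ≤-decTotalOrder w

  open Sort byWeight using (sort; sort-↭; sort-↗)

  colouring : ∃ λ (c : Fin m → Fin (suc k)) → ∀ i j → i ≢ j → i ~ j → c i ≢ c j
  colouring with c , proper ← colourList (Sorted⇒AllPairs (DecTotalOrder.totalOrder byWeight)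
                                            (sort-↗ (allFin m)))
    = c , λ i j → proper (listed i) (listed j)
    where
    listed : ∀ i → i ∈ˡ sort (allFin m)
    listed i = ∈-resp-↭ (↭-sym (sort-↭ (allFin m))) (∈-allFin i)

-- Neighbours in the 2-section through one hyperedge.

module _ {n m : ℕ} (H : Hypergraph n m) where
  open Hypergraph H
  open SimpleGraph (twoSection H) using (maxDegree; adj?) renaming (degree to degree₂)

  degree₂≤maxDegree : ∀ y → degree₂ y ≤ maxDegree
  degree₂≤maxDegree y = All.lookup (xs≤max 0 (map degree₂ (allFin n))) (∈-map⁺ degree₂ (∈-allFin y))

  -- Adjacency in the 2-section with its witnessing hyperedge fixed, so that neighbours can be
  -- counted hyperedge by hyperedge.
  Via : Fin n → Fin m → Fin n → Set
  Via y i z = y ≢ z × y ∈ edge i × z ∈ edge i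

  via? : ∀ y i → Decidable (Via y i)
  via? y i z = ¬? (y ≟ z) ×-dec (y ∈? edge i) ×-dec (z ∈? edge i)

  neighboursVia : Fin n → Fin m → List (Fin n)
  neighboursVia y i = filter (via? y i) (allFin n)

  ∈-neighboursVia⁺ : ∀ {y i z} → Via y i z → z ∈ˡ neighboursVia y i
  ∈-neighboursVia⁺ = ∈-filter⁺ (via? _ _) (∈-allFin _)

  ∈-neighboursVia⁻ : ∀ {y i z} → z ∈ˡ neighboursVia y i → Via y i z
  ∈-neighboursVia⁻ = proj₂ ∘ ∈-filter⁻ (via? _ _) {xs = allFin n}

  neighboursVia-unique : ∀ y i → Unique (neighboursVia y i)
  neighboursVia-unique y i = filter⁺ (via? y i) (allFin⁺ n)

  -- `y` followed by its neighbours via `i` is a repetition-free list of the vertices of `edge i`;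
  -- mutual inclusion gives equal lengths.
  length-neighboursVia : ∀ {y i} → y ∈ edge i → suc (length (neighboursVia y i)) ≡ ∣ edge i ∣
  length-neighboursVia {y} {i} y∈e = trans
    (≤-antisym
      (Unique-⊆⇒length≤ (All.tabulate (proj₁ ∘ ∈-neighboursVia⁻) ∷ neighboursVia-unique y i) λ where
        (here refl) → ∈-members y∈e
        (there z∈)  → ∈-members (proj₂ (proj₂ (∈-neighboursVia⁻ z∈))))
      (Unique-⊆⇒length≤ (filter⁺ (_∈? edge i) (allFin⁺ n)) λ z∈ →
        split (proj₂ (∈-filter⁻ (_∈? edge i) {xs = allFin n} z∈))))
    (length-members (edge i))
    where
    split : ∀ {z} → z ∈ edge i → z ∈ˡ y ∷ neighboursVia y i
    split {z} z∈e with y ≟ z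
    ... | yes refl = here refl
    ... | no  y≢z  = there (∈-neighboursVia⁺ (y≢z , y∈e , z∈e))

  -- Hyperedges at least as large as a given one.

  -- The inequality is weak because a hyperedge of the same size may be coloured earlier.
  LargerThrough : Fin m → Fin n → Fin m → Set
  LargerThrough i y j = i ≢ j × ∣ edge i ∣ ≤ ∣ edge j ∣ × y ∈ edge j

  largerThrough? : ∀ i y → Decidable (LargerThrough i y)
  largerThrough? i y j = ¬? (i ≟ j) ×-dec (∣ edge i ∣ ≤? ∣ edge j ∣) ×-dec (y ∈? edge j)

  largerThrough : Fin m → Fin n → List (Fin m)
  largerThrough i y = filter (largerThrough? i y) (allFin m)

  ∈-largerThrough⁻ : ∀ {i y j} → j ∈ˡ largerThrough i y → LargerThrough i y j
  ∈-largerThrough⁻ = proj₂ ∘ ∈-filter⁻ (largerThrough? _ _) {xs = allFin m}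

  i∷largerThrough-unique : ∀ i y → Unique (i ∷ largerThrough i y)
  i∷largerThrough-unique i y =
    All.tabulate (proj₁ ∘ ∈-largerThrough⁻) ∷ filter⁺ (largerThrough? i y) (allFin⁺ m)

  ∈-i∷largerThrough⁻ : ∀ {i y j} → y ∈ edge i → j ∈ˡ i ∷ largerThrough i y →
                       ∣ edge i ∣ ≤ ∣ edge j ∣ × y ∈ edge j
  ∈-i∷largerThrough⁻ y∈e (here refl) = ≤-refl , y∈e
  ∈-i∷largerThrough⁻ y∈e (there j∈)  = proj₂ (∈-largerThrough⁻ j∈)

  suc-length-largerThrough≤degree : ∀ {i y} → y ∈ edge i → suc (length (largerThrough i y)) ≤ degree H y
  suc-length-largerThrough≤degree {i} {y} y∈e =
    Unique-⊆⇒length≤ (i∷largerThrough-unique i y) λ j∈ →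
      ∈-filter⁺ (λ j → y ∈? edge j) (∈-allFin _) (proj₂ (∈-i∷largerThrough⁻ y∈e j∈))

  -- The vertex `x` stands apart because its share is bounded by its degree in `H`, while the shares
  -- of the other vertices of the hyperedge are bounded by degrees in the 2-section.
  touchingLarger : Fin m → Fin n → List (Fin m)
  touchingLarger i x = largerThrough i x ++ concatMap (largerThrough i) (neighboursVia x i)

  touchingLarger-complete : ∀ {i x j} → x ∈ edge i → i ≢ j → Nonempty (edge i ∩ edge j) →
                            ∣ edge i ∣ ≤ ∣ edge j ∣ → j ∈ˡ touchingLarger i x
  touchingLarger-complete {i} {x} {j} x∈e i≢j (y , y∈e∩e′) e≤e′
    with y∈e , y∈e′ ← x∈p∩q⁻ (edge i) (edge j) y∈e∩e′
    with j∈ ← ∈-filter⁺ (largerThrough? i y) (∈-allFin j) (i≢j , e≤e′ , y∈e′)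
    with x ≟ y
  ... | yes refl = ∈-++⁺ˡ j∈
  ... | no  x≢y  = ∈-++⁺ʳ (largerThrough i x)
                     (∈-concatMap⁺ (largerThrough i) (lose (∈-neighboursVia⁺ (x≢y , x∈e , y∈e)) j∈))

  -- Counting under linearity.

  module _ (linear : Linear H) where

    -- A common neighbour `z` would give the two hyperedges a second common vertex besides `y`.
    neighboursVia-disjoint : ∀ y {i j} → i ≢ j → Disjoint (neighboursVia y i) (neighboursVia y j)
    neighboursVia-disjoint y {i} {j} i≢j (z∈ᵢ , z∈ⱼ)
      with y≢z , y∈eᵢ , z∈eᵢ ← ∈-neighboursVia⁻ z∈ᵢ | _ , y∈eⱼ , z∈eⱼ ← ∈-neighboursVia⁻ z∈ⱼ
      = <⇒≱ (distinct∈⇒1<∣p∣ y≢z (x∈p∩q⁺ (y∈eᵢ , y∈eⱼ)) (x∈p∩q⁺ (z∈eᵢ , z∈eⱼ))) (linear i j i≢j)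

    -- By disjointness the concatenation has no repetitions, and all its entries are adjacent to `y`
    -- in the 2-section.
    length-concatMap-neighboursVia≤degree₂ : ∀ y {D} → Unique D →
                                             length (concatMap (neighboursVia y) D) ≤ degree₂ y
    length-concatMap-neighboursVia≤degree₂ y {D} D! = Unique-⊆⇒length≤
      (concat⁺ (All-map⁺ (All.tabulate λ {i} _ → neighboursVia-unique y i))
               (AllPairs-map⁺ (AllPairs.map (neighboursVia-disjoint y) D!)))
      λ z∈ → let i , _ , z∈ᵢ = find (∈-concatMap⁻ (neighboursVia y) {xs = D} z∈)
                 y≢z , both  = ∈-neighboursVia⁻ z∈ᵢ
             in ∈-filter⁺ (adj? y) (∈-allFin _) (y≢z , i , both)

    -- The hyperedge `i` and the larger ones through `y` each contribute at least `s` neighbours of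
    -- `y`, and no neighbour is contributed twice.
    suc-length-largerThrough*≤maxDegree : ∀ {i y s} → suc s ≡ ∣ edge i ∣ → y ∈ edge i →
                                          suc (length (largerThrough i y)) * s ≤ maxDegree
    suc-length-largerThrough*≤maxDegree {i} {y} {s} size y∈e = begin
      length D * s                           ≤⟨ length-concatMap-≥ (neighboursVia y) long ⟩
      length (concatMap (neighboursVia y) D) ≤⟨ length-concatMap-neighboursVia≤degree₂ y
                                                  (i∷largerThrough-unique i y) ⟩
      degree₂ y                              ≤⟨ degree₂≤maxDegree y ⟩
      maxDegree                              ∎
      where
      open ≤-Reasoning

      D : List (Fin m)
      D = i ∷ largerThrough i y

      long : ∀ {j} → j ∈ˡ D → s ≤ length (neighboursVia y j)
      long j∈ with e≤e′ , y∈e′ ← ∈-i∷largerThrough⁻ y∈e j∈ =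
        ≤-pred (≤-trans (≤-reflexive size) (≤-trans e≤e′ (≤-reflexive (sym (length-neighboursVia y∈e′)))))

    length-touchingLarger : ∀ {i x} → x ∈ edge i → degree H x ≤ ∣ edge i ∣ →
                            length (touchingLarger i x) ≤ maxDegree
    length-touchingLarger {i} {x} x∈e deg≤ = begin
      length (touchingLarger i x)
        ≡⟨ length-++ (largerThrough i x) ⟩
      length (largerThrough i x) + length (concatMap (largerThrough i) T)
        -- The share of `x` is at most one hyperedge per vertex of `T`. Each such unit makes up for
        -- `i` itself, which is missing from `largerThrough i y` but counted in the product bound at
        -- `y`.
        ≤⟨ +-monoˡ-≤ _ at-x ⟩
      length T + length (concatMap (largerThrough i) T)
        ≡⟨ +-comm (length T) _ ⟩
      length (concatMap (largerThrough i) T) + length T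
        -- Here `s` is `length T`, so the number of vertices summed over equals the factor to be
        -- cancelled.
        ≤⟨ cancel T (length-concatMap-≤ (largerThrough i) T λ y∈ →
             suc-length-largerThrough*≤maxDegree (length-neighboursVia x∈e)
               (proj₂ (proj₂ (∈-neighboursVia⁻ y∈)))) ⟩
      maxDegree ∎
      where
      open ≤-Reasoning

      T : List (Fin n)
      T = neighboursVia x i

      at-x : length (largerThrough i x) ≤ length T
      at-x = ≤-pred (≤-trans (suc-length-largerThrough≤degree x∈e)
               (≤-trans deg≤ (≤-reflexive (sym (length-neighboursVia x∈e)))))

      cancel : ∀ T {Δ} → (length (concatMap (largerThrough i) T) + length T) * length T ≤ length T * Δ →
               length (concatMap (largerThrough i) T) + length T ≤ Δ
      -- For a hyperedge with the single vertex `x` there is no positive factor to cancel, but the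
      -- left side is zero.
      cancel []      _     = z≤n
      cancel (y ∷ T) {Δ} bound = *-cancelʳ-≤ _ _ (suc (length T)) (≤-trans bound (≤-reflexive (*-comm _ Δ)))

-- The bound on the chromatic index.

theorem1p5 : ∀ {n m : ℕ} (H : Hypergraph n m) → Linear H →
    (∀ (i : Fin m) → ∃ λ (x : Fin n) → x ∈ Hypergraph.edge H i × degree H x ≤ ∣ Hypergraph.edge H i ∣) →
    chromaticIndex H ≤ SimpleGraph.maxDegree (twoSection H) + 1
theorem1p5 {n} {m} H linear small =
  -- By minimality of the chromatic index, one proper colouring with `suc Δ` colours is enough.
  proj₂ (chromaticIndex-isChromaticIndex H) _
    (subst (EdgeColourable H) (+-comm 1 Δ) colouring)
  where
  open Hypergraph H

  Δ : ℕ
  Δ = SimpleGraph.maxDegree (twoSection H)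

  Meet : Rel (Fin m) 0ℓ
  Meet i j = Nonempty (edge i ∩ edge j)

  Meet-sym : Symmetric Meet
  Meet-sym {i} {j} = subst Nonempty (∩-comm (edge i) (edge j))

  -- The graph to be coloured is the intersection graph of the hyperedges, weighted by size; `small`
  -- supplies the vertex of low degree in each.
  open Greedy Meet-sym (λ i → ∣ edge i ∣) (λ i → touchingLarger H i (proj₁ (small i)))
    (λ {i} → touchingLarger-complete H (proj₁ (proj₂ (small i))))
    (λ i → length-touchingLarger H linear (proj₁ (proj₂ (small i))) (proj₂ (proj₂ (small i))))
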